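{- Let $L$ be a non-empty countable relational language, let $T$ be a first order theory in $L$, and let $F$ be any countable fragment of $L_{\omega_1\omega}$. If there is an uncountable set of countably infinite models of $T$ (that is, an uncountable set of $x\in X_L$ with $\mathcal{U}_x\models T$) that are pairwise separable in $F$, then there is a set of countably infinite models of $T$ of size $2^{\aleph_0}$ that are pairwise separable in $F$ (and so $T$ has $2^{\aleph_0}$ pairwise non-isomorphic countable models).
   Context: $L=(R_i)_{i\in I}$ is a non-empty countable relational language, where $I$ is a non-empty countable index set and $R_i$ is an $n_i$-ary relation symbol. Put $X_L=\prod_{i\in I}2^{(\mathbb{N}^{n_i})}$, viewed as the space of countably infinite $L$-structures: each $x\in X_L$ codes the $L$-structure $\mathcal{U}_x$ with universe $\mathbb{N}$ in which $R_i$ is interpreted by the relation whose characteristic function is $x(i)$. $L_{\omega_1\omega}$ is the usual infinitary logic (countable conjunctions and disjunctions, finite quantifier strings); formulas have finitely many free variables. For a formula $\varphi$, $\Delta\varphi$ denotes its (finite) set of free variables, and ${}^{|\Delta\varphi|}\omega$ is the set of sequences of natural numbers of length $|\Delta\varphi|$ (here $\omega=\mathbb{N}$). A fragment $F$ of $L_{\omega_1\omega}$ is a set of formulas of $L_{\omega_1\omega}$ containing all atomic formulas and closed under subformulas, negation, quantifiers, and finite conjunctions and disjunctions. For $x\in X_L$ and a formula $\varphi$, let $\varphi^x=\{\bar s\in{}^{|\Delta\varphi|}\omega:\mathcal{U}_x\models\varphi[\bar s]\}$, where $\varphi[\bar s]$ is obtained by substituting $\bar s$ for the free variables of $\varphi$.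 If $\varphi$ is a sentence, $\varphi^x$ is either empty or contains only the empty sequence. Two elements $x,y\in X_L$ (or their corresponding structures $\mathcal{U}_x,\mathcal{U}_y$) are separable in $F$ if there is $\varphi\in F$ such that $|\varphi^x|\neq|\varphi^y|$. -}

module Defs where

open import Data.Bool using (Bool; true)
open import Data.List using (List; []; _∷_; length)
open import Data.List.Relation.Unary.AllPairs using (AllPairs)
import Data.List.Membership.Propositional as List
open import Data.Nat using (ℕ; _<_; _≟_)
open import Data.Product using (Σ; Σ-syntax; ∃; ∃-syntax; _×_; proj₁)
open import Data.Sum using (_⊎_)
open import Data.Vec using (Vec; []; _∷_; map)
import Data.Vec.Membership.Propositional as Vec
open import Function.Bundles using (Injection; Bijection; _⇔_; _⤖_; module Bijection)
open import Level using (0ℓ)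
open import Relation.Binary.Bundles using (Setoid)
open import Relation.Binary.Construct.Closure.ReflexiveTransitive using (Star)
import Relation.Binary.Construct.On as On
open import Relation.Binary.PropositionalEquality
  using (_≡_; _≢_; refl; sym; trans; setoid; _→-setoid_)
open import Relation.Nullary using (¬_; yes; no)
open import Relation.Unary using (Pred; _∈_)

-- Sets are setoids, because elements of X L are functions and are compared
-- pointwise.  The equality of a subset ignores the proofs of membership, so
-- that cardinalities count elements and not proofs.

SubsetOf : (A : Setoid 0ℓ 0ℓ) → Pred (Setoid.Carrier A) 0ℓ → Setoid 0ℓ 0ℓ
SubsetOf A P = On.setoid {B = Σ (Setoid.Carrier A) P} A proj₁

SameCardinality : Setoid 0ℓ 0ℓ → Setoid 0ℓ 0ℓ → Set
SameCardinality A B = Bijection A B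

-- Finite or countably infinite.
Countable : Setoid 0ℓ 0ℓ → Set
Countable A = Injection A (setoid ℕ)

HasSizeContinuum : Setoid 0ℓ 0ℓ → Set
HasSizeContinuum A = SameCardinality (ℕ →-setoid Bool) A

record Language : Set₁ where
  field
    Symbol : Set
    arity  : Symbol → ℕ

open Language public

CountableLanguage : Language → Set
CountableLanguage L = Countable (setoid (Symbol L))

Var : Set
Var = ℕ

-- Infinitary formulas before the requirement that only finitely many
-- variables be free (see InLω₁ω).  ⋀ and ⋁ are the countably infinite
-- conjunctions and disjunctions; finite ones are iterations of ∧′ and ∨′.

infix  9 _≐_
infixr 7 _∧′_
infixr 6 _∨′_

data Formula (L : Language) : Set where
  _≐_       : Var → Var → Formula L
  rel       : (i : Symbol L) → Vec Var (arity L i) → Formula L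
  ¬′_       : Formula L → Formula L
  _∧′_ _∨′_ : Formula L → Formula L → Formula L
  ⋀ ⋁       : (ℕ → Formula L) → Formula L
  ∀′ ∃′     : Var → Formula L → Formula L

module _ {L : Language} where

  data Atomic : Pred (Formula L) 0ℓ where
    _≐_ : ∀ u v → Atomic (u ≐ v)
    rel : ∀ i us → Atomic (rel i us)

  data FirstOrder : Pred (Formula L) 0ℓ where
    atomic : ∀ {φ} → Atomic φ → FirstOrder φ
    ¬′_    : ∀ {φ} → FirstOrder φ → FirstOrder (¬′ φ)
    _∧′_   : ∀ {φ ψ} → FirstOrder φ → FirstOrder ψ → FirstOrder (φ ∧′ ψ)
    _∨′_   : ∀ {φ ψ} → FirstOrder φ → FirstOrder ψ → FirstOrder (φ ∨′ ψ)
    ∀′     : ∀ {φ} v → FirstOrder φ → FirstOrder (∀′ v φ)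
    ∃′     : ∀ {φ} v → FirstOrder φ → FirstOrder (∃′ v φ)

  data ImmediateSubformula : Formula L → Formula L → Set where
    ¬-sub  : ∀ {φ} → ImmediateSubformula φ (¬′ φ)
    ∧-subˡ : ∀ {φ ψ} → ImmediateSubformula φ (φ ∧′ ψ)
    ∧-subʳ : ∀ {φ ψ} → ImmediateSubformula ψ (φ ∧′ ψ)
    ∨-subˡ : ∀ {φ ψ} → ImmediateSubformula φ (φ ∨′ ψ)
    ∨-subʳ : ∀ {φ ψ} → ImmediateSubformula ψ (φ ∨′ ψ)
    ⋀-sub  : ∀ {Φ} n → ImmediateSubformula (Φ n) (⋀ Φ)
    ⋁-sub  : ∀ {Φ} n → ImmediateSubformula (Φ n) (⋁ Φ)
    ∀-sub  : ∀ {v φ} → ImmediateSubformula φ (∀′ v φ)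
    ∃-sub  : ∀ {v φ} → ImmediateSubformula φ (∃′ v φ)

  Subformula : Formula L → Formula L → Set
  Subformula = Star ImmediateSubformula

  _FreeIn_ : Var → Formula L → Set
  v FreeIn (u ≐ w)    = v ≡ u ⊎ v ≡ w
  v FreeIn (rel i us) = v Vec.∈ us
  v FreeIn (¬′ φ)     = v FreeIn φ
  v FreeIn (φ ∧′ ψ)   = v FreeIn φ ⊎ v FreeIn ψ
  v FreeIn (φ ∨′ ψ)   = v FreeIn φ ⊎ v FreeIn ψ
  v FreeIn (⋀ Φ)      = ∃[ n ] v FreeIn Φ n
  v FreeIn (⋁ Φ)      = ∃[ n ] v FreeIn Φ n
  v FreeIn (∀′ u φ)   = v ≢ u × v FreeIn φ
  v FreeIn (∃′ u φ)   = v ≢ u × v FreeIn φ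

  Sentence : Pred (Formula L) 0ℓ
  Sentence φ = ∀ v → ¬ (v FreeIn φ)

  -- Δφ, listed in increasing order, so the list is unique when it exists and
  -- its length is |Δφ|.
  record FreeVariables (φ : Formula L) : Set where
    field
      Δ        : List Var
      sorted   : AllPairs _<_ Δ
      complete : ∀ v → v List.∈ Δ ⇔ v FreeIn φ

  open FreeVariables public

  -- Every subformula of a formula with finitely many free variables again has
  -- finitely many, so nothing needs to be said about subformulas.
  InLω₁ω : Pred (Formula L) 0ℓ
  InLω₁ω φ = FreeVariables φ

  record IsFragment (F : Pred (Formula L) 0ℓ) : Set where
    field
      formulas    : ∀ {φ} → φ ∈ F → InLω₁ω φ
      atomics     : ∀ {φ} → Atomic φ → φ ∈ F
      subformulas : ∀ {φ ψ} → Subformula φ ψ → ψ ∈ F → φ ∈ F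
      ¬-closed    : ∀ {φ} → φ ∈ F → (¬′ φ) ∈ F
      ∧-closed    : ∀ {φ ψ} → φ ∈ F → ψ ∈ F → (φ ∧′ ψ) ∈ F
      ∨-closed    : ∀ {φ ψ} → φ ∈ F → ψ ∈ F → (φ ∨′ ψ) ∈ F
      ∀-closed    : ∀ {φ} v → φ ∈ F → ∀′ v φ ∈ F
      ∃-closed    : ∀ {φ} v → φ ∈ F → ∃′ v φ ∈ F

  CountableFormulas : Pred (Formula L) 0ℓ → Set
  CountableFormulas F = Countable (SubsetOf (setoid (Formula L)) F)

  IsFirstOrderTheory : Pred (Formula L) 0ℓ → Set
  IsFirstOrderTheory T = ∀ {φ} → φ ∈ T → FirstOrder φ × Sentence φ

X : Language → Set
X L = (i : Symbol L) → Vec ℕ (arity L i) → Bool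

X-setoid : Language → Setoid 0ℓ 0ℓ
X-setoid L = record
  { Carrier       = X L
  ; _≈_           = λ x y → ∀ i s → x i s ≡ y i s
  ; isEquivalence = record
    { refl  = λ _ _ → refl
    ; sym   = λ p i s → sym (p i s)
    ; trans = λ p q i s → trans (p i s) (q i s)
    }
  }

Assignment : Set
Assignment = Var → ℕ

infixl 10 _[_↦_]

_[_↦_] : Assignment → Var → ℕ → Assignment
(σ [ v ↦ a ]) u with u ≟ v
... | yes _ = a
... | no  _ = σ u

-- Only the values at the listed variables matter; the others are set to 0.
assign : (vs : List Var) → Vec ℕ (length vs) → Assignment
assign []       []      = λ _ → 0
assign (v ∷ vs) (a ∷ s) = assign vs s [ v ↦ a ]

module _ {L : Language} where

  infix 4 _,_⊨_ _⊨ᵀ_ _≅_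

  _,_⊨_ : X L → Assignment → Formula L → Set
  x , σ ⊨ (u ≐ v)    = σ u ≡ σ v
  x , σ ⊨ (rel i us) = x i (map σ us) ≡ true
  x , σ ⊨ (¬′ φ)     = ¬ (x , σ ⊨ φ)
  x , σ ⊨ (φ ∧′ ψ)   = (x , σ ⊨ φ) × (x , σ ⊨ ψ)
  x , σ ⊨ (φ ∨′ ψ)   = (x , σ ⊨ φ) ⊎ (x , σ ⊨ ψ)
  x , σ ⊨ (⋀ Φ)      = ∀ n → x , σ ⊨ Φ n
  x , σ ⊨ (⋁ Φ)      = ∃[ n ] (x , σ ⊨ Φ n)
  x , σ ⊨ (∀′ v φ)   = ∀ a → x , σ [ v ↦ a ] ⊨ φ
  x , σ ⊨ (∃′ v φ)   = ∃[ a ] (x , σ [ v ↦ a ] ⊨ φ)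

  -- The members of T are sentences, so the assignment is immaterial.
  _⊨ᵀ_ : X L → Pred (Formula L) 0ℓ → Set
  x ⊨ᵀ T = ∀ {φ} → φ ∈ T → ∀ σ → x , σ ⊨ φ

  -- φ^x
  Definable : (φ : Formula L) (fv : FreeVariables φ) → X L → Pred (Vec ℕ (length (Δ fv))) 0ℓ
  Definable φ fv x s = x , assign (Δ fv) s ⊨ φ

  DefinableSet : (φ : Formula L) → FreeVariables φ → X L → Setoid 0ℓ 0ℓ
  DefinableSet φ fv x = SubsetOf (setoid (Vec ℕ (length (Δ fv)))) (Definable φ fv x)

  Separable : Pred (Formula L) 0ℓ → X L → X L → Set
  Separable F x y =
    ∃[ φ ] φ ∈ F × (Σ[ fv ∈ FreeVariables φ ]
      ¬ SameCardinality (DefinableSet φ fv x) (DefinableSet φ fv y))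

  _≅_ : X L → X L → Set
  x ≅ y = Σ[ f ∈ ℕ ⤖ ℕ ] (∀ i s → x i s ≡ y i (map (Bijection.to f) s))

  Pairwise : (X L → X L → Set) → Pred (X L) 0ℓ → Set
  Pairwise R S = ∀ {x y} → x ∈ S → y ∈ S → ¬ Setoid._≈_ (X-setoid L) x y → R x y

  SetOfModels : Pred (Formula L) 0ℓ → Pred (X L) 0ℓ → Set
  SetOfModels T S = ∀ {x} → x ∈ S → x ⊨ᵀ T

{-# OPTIONS --safe #-}

-- S is split into a binary tree of uncountable subsets.  A countable union of
-- countable sets being countable, a node N can always be shrunk to an
-- uncountable subset on which a given φ ∈ F has a constant truth value at given
-- arguments, together with a constant witness or counterexample when φ is an
-- infinitary connective or a quantifier.  Likewise some statement |φˣ| ≥ n must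
-- be true on uncountably many points of N and false on uncountably many:
-- otherwise, discarding the countable side of each of these countably many
-- statements leaves points that agree on all cardinalities |φˣ|, hence at most
-- one.  These two sides, the positive one with constant witnesses, are the
-- children of N.  Along a branch the facts that eventually hold on the nodes
-- form a Henkin-complete diagram, hence determine a model of T, and two branches
-- that part ways at (φ, n) give models separated by φ.

module Submission where

open import Defs
open import Axiom.ExcludedMiddle using (ExcludedMiddle)
open import Data.Bool using (Bool; true; false)
open import Data.Bool.Properties using (T-irrelevant)
open import Data.Fin using (Fin; zero; suc; toℕ; fromℕ<)
open import Data.Fin.Properties using (toℕ<n; toℕ-injective; toℕ-fromℕ<; injective⇒≤)
open import Data.List using (List; []; _∷_; applyUpTo; length)
open import Data.List.Extrema.Nat using (max; xs≤max)
import Data.List.Membership.Propositional as List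
import Data.List.Relation.Unary.All as All
import Data.List.Relation.Unary.Any as Any
open import Data.Maybe using (Maybe; just; nothing)
open import Data.Nat using (ℕ; zero; suc; _≤_; _<_; z≤n; s≤s; s≤s⁻¹; _≟_; _⊔_)
open import Data.Nat.Binary as ℕᵇ using (ℕᵇ; zero; 2[1+_]; 1+[2_])
import Data.Nat.Binary.Properties as ℕᵇ
open import Data.Nat.Properties
open import Data.Product as Product
  using (Σ; Σ-syntax; ∃; ∃-syntax; _×_; _,_; proj₁; proj₂; map₁; map₂)
open import Data.Sum as Sum using (_⊎_; inj₁; inj₂; [_,_]′)
open import Data.Unit using (⊤; tt)
open import Data.Vec using (Vec; []; _∷_; lookup; tabulate; map)
import Data.Vec.Membership.Propositional as Vec
open import Data.Vec.Properties using (map-id; ∷-injective; lookup∘tabulate)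
open import Data.Vec.Relation.Unary.Any using (here; there)
open import Function using (_∘_; id)
open import Function.Bundles
  using (Injection; Surjection; _↣_; _⇔_; mk↣; mk⇔; module Injection; module Surjection;
         module Bijection; module Equivalence)
import Function.Construct.Composition as Composition
open import Function.Construct.Identity using (↣-id; ⤖-id; ⇔-id)
open import Function.Definitions using (Injective)
open import Level using (0ℓ)
open import Relation.Binary.Bundles using (Setoid)
open import Relation.Binary.Construct.Closure.ReflexiveTransitive using (ε; _◅_)
open import Relation.Binary.Definitions using (tri<; tri≈; tri>)
open import Relation.Binary.PropositionalEquality
open import Relation.Nullary using (¬_; does; yes; no; contradiction)
open import Relation.Nullary.Decidable
  using (True; toWitness; fromWitness; decidable-stable; does-⇔)
open import Relation.Unary using (Pred; _∈_; _⊆_; _∩_; _∪_; ∁)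

module E = Equivalence

-- Countable types

-- Pairs are coded by bijective binary numerals, whose digits are unique: two runs of the digit
-- `2[1+_]`, with one `1+[2_]` marking where the first run ends.
unary : ℕ → ℕᵇ → ℕᵇ
unary zero    t = t
unary (suc a) t = 2[1+ unary a t ]

unary-injective : ∀ {a b} → unary a zero ≡ unary b zero → a ≡ b
unary-injective {zero}  {zero}  _  = refl
unary-injective {suc _} {suc _} eq = cong suc (unary-injective (ℕᵇ.2[1+_]-injective eq))

unary-separated : ∀ {a b s t} → unary a 1+[2 s ] ≡ unary b 1+[2 t ] → a ≡ b × s ≡ t
unary-separated {zero}  {zero}  refl = refl , refl
unary-separated {suc _} {suc _} eq   = map₁ (cong suc) (unary-separated (ℕᵇ.2[1+_]-injective eq))

abstract
  pair : ℕ → ℕ → ℕ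
  pair a b = ℕᵇ.toℕ (unary a 1+[2 unary b zero ])

  pair-injective : ∀ {a b c d} → pair a b ≡ pair c d → a ≡ c × b ≡ d
  pair-injective eq = map₂ unary-injective (unary-separated (ℕᵇ.toℕ-injective eq))

×-countable : {A B : Set} → A ↣ ℕ → B ↣ ℕ → (A × B) ↣ ℕ
×-countable f g = mk↣ {to = λ (a , b) → pair (to f a) (to g b)} λ eq →
  let p , q = pair-injective eq in cong₂ _,_ (injective f p) (injective g q)
  where open Injection

Vec-countable : {A : Set} → A ↣ ℕ → ∀ n → Vec A n ↣ ℕ
Vec-countable {A} f n = mk↣ code-injective
  where
  open Injection f using (to; injective)
  code : ∀ {n} → Vec A n → ℕ
  code []       = 0
  code (a ∷ as) = pair (to a) (code as)

  code-injective : ∀ {n} → Injective _≡_ _≡_ (code {n})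
  code-injective {x = []}    {[]}    _  = refl
  code-injective {x = _ ∷ _} {_ ∷ _} eq =
    let p , q = pair-injective eq in cong₂ _∷_ (injective p) (code-injective q)

List-countable : List ℕ ↣ ℕ
List-countable = mk↣ code-injective
  where
  code : List ℕ → ℕ
  code []       = 0
  code (a ∷ as) = suc (pair a (code as))

  code-injective : Injective _≡_ _≡_ code
  code-injective {[]}    {[]}    _  = refl
  code-injective {_ ∷ _} {_ ∷ _} eq =
    let p , q = pair-injective (suc-injective eq) in cong₂ _∷_ p (code-injective q)

-- Cardinalities of subsets of a countable set

-- For subsets of a countable set these statements determine the cardinality, and each has a finite
-- witness.
AtLeast : {D : Set} → ℕ → Pred D 0ℓ → Set
AtLeast {D} n P = Σ[ w ∈ (Fin n → D) ] Injective _≡_ _≡_ w × (∀ i → P (w i))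

module Classical (em : ExcludedMiddle 0ℓ) where

  byContradiction : {P : Set} → ¬ ¬ P → P
  byContradiction = decidable-stable em

  -- Proof-irrelevant, so that a code of elements that ignores proofs of
  -- membership is injective on pairs of an element and such a proof.
  ∥_∥ : Set → Set
  ∥ P ∥ = True (em {P})

  squash-countable : {A : Set} {P : Pred A 0ℓ} →
    Countable (SubsetOf (setoid A) P) → (Σ[ a ∈ A ] ∥ P a ∥) ↣ ℕ
  squash-countable f = mk↣ {to = λ (a , p) → to (a , toWitness p)} λ {(a , p)} {(b , q)} eq →
    Σ-≡ (injective eq)
    where
    open Injection f using (to; injective)
    Σ-≡ : ∀ {p q} → proj₁ p ≡ proj₁ q → p ≡ q
    Σ-≡ {a , p} {.a , q} refl = cong (a ,_) (T-irrelevant p q)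

  decode : {A : Set} → A ↣ ℕ → ℕ → Maybe A
  decode f n with em {∃[ a ] Injection.to f a ≡ n}
  ... | yes (a , _) = just a
  ... | no  _       = nothing

  decode-code : {A : Set} (f : A ↣ ℕ) (a : A) → decode f (Injection.to f a) ≡ just a
  decode-code f a with em {∃[ b ] Injection.to f b ≡ Injection.to f a}
  ... | yes (b , eq) = cong just (Injection.injective f eq)
  ... | no  ¬∃       = contradiction (a , refl) ¬∃

  least : (Q : Pred ℕ 0ℓ) → ∀ n → Q n → ∃[ m ] Q m × (∀ {k} → Q k → m ≤ k)
  least Q n q with em {Q 0}
  least Q n       q | yes q₀ = 0 , q₀ , λ _ → z≤n
  least Q zero    q | no ¬q₀ = contradiction q ¬q₀
  least Q (suc n) q | no ¬q₀ =
    let m , qm , m-least = least (Q ∘ suc) n q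
    in suc m , qm , λ { {zero} q₀ → contradiction q₀ ¬q₀ ; {suc _} qk → s≤s (m-least qk) }

  module Cardinality {D : Set} (code : D ↣ ℕ) where
    open Injection code using (to; injective)

    module Rank (P : Pred D 0ℓ) where

      -- The number of elements of `P` with code below the argument. Thus `rank` enumerates `P` in
      -- the order of codes, along an initial segment of ℕ.
      count : ℕ → ℕ
      count zero    = 0
      count (suc m) with em {∃[ d ] to d ≡ m × P d}
      ... | yes _ = suc (count m)
      ... | no  _ = count m

      rank : D → ℕ
      rank d = count (to d)

      count-step : ∀ m → count m ≤ count (suc m)
      count-step m with em {∃[ d ] to d ≡ m × P d}
      ... | yes _ = n≤1+n _
      ... | no  _ = ≤-refl

      count-mono : ∀ {m n} → m ≤ n → count m ≤ count n
      count-mono {n = zero} z≤n = ≤-refl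
      count-mono {m} {suc n} m≤1+n with m ≟ suc n
      ... | yes refl = ≤-refl
      ... | no  m≢   = ≤-trans (count-mono (s≤s⁻¹ (≤∧≢⇒< m≤1+n m≢))) (count-step n)

      count-suc-code : ∀ {d} → P d → count (suc (to d)) ≡ suc (rank d)
      count-suc-code {d} p with em {∃[ e ] to e ≡ to d × P e}
      ... | yes _  = refl
      ... | no  ¬∃ = contradiction (d , refl , p) ¬∃

      rank-strict : ∀ {d e} → P d → to d < to e → rank d < rank e
      rank-strict p d<e = subst (_≤ _) (count-suc-code p) (count-mono d<e)

      rank-injective : ∀ {d e} → P d → P e → rank d ≡ rank e → d ≡ e
      rank-injective {d} {e} p q eq with <-cmp (to d) (to e)
      ... | tri< d<e _ _ = contradiction eq (<⇒≢ (rank-strict p d<e))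
      ... | tri≈ _ d≡e _ = injective d≡e
      ... | tri> _ _ e<d = contradiction (sym eq) (<⇒≢ (rank-strict q e<d))

      -- `count` starts at 0 and grows by at most one at a time, exactly where it meets an element
      -- of `P`, so no value is skipped.
      rank-attained : ∀ m {r} → r < count m → ∃[ d ] P d × rank d ≡ r
      rank-attained (suc m) {r} r<count with em {∃[ d ] to d ≡ m × P d}
      ... | no _ = rank-attained m r<count
      ... | yes (d , d≡m , p) with r ≟ count m
      ...   | yes r≡ = d , p , trans (cong count d≡m) (sym r≡)
      ...   | no  r≢ = rank-attained m (≤∧≢⇒< (s≤s⁻¹ r<count) r≢)

      -- If `count` never exceeded `r`, the ranks of the `suc r` given elements would be distinct
      -- numbers below `r`.
      AtLeast⇒rank : ∀ {r} → AtLeast (suc r) P → ∃[ d ] P d × rank d ≡ r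
      AtLeast⇒rank {r} (w , w-inj , p) with em {∃[ m ] r < count m}
      ... | yes (m , r<) = rank-attained m r<
      ... | no  bounded  = contradiction (injective⇒≤ ranks-injective) 1+n≰n
        where
        rank<r : ∀ i → rank (w i) < r
        rank<r i = subst (_≤ r) (count-suc-code (p i)) (≮⇒≥ (bounded ∘ (_ ,_)))

        ranks-injective : Injective _≡_ _≡_ (λ i → fromℕ< (rank<r i))
        ranks-injective {i} {j} eq = w-inj (rank-injective (p i) (p j)
          (trans (sym (toℕ-fromℕ< (rank<r i))) (trans (cong toℕ eq) (toℕ-fromℕ< (rank<r j)))))

      rank⇒AtLeast : ∀ {d} → P d → AtLeast (suc (rank d)) P
      rank⇒AtLeast {d} p = proj₁ ∘ below , inj , proj₁ ∘ proj₂ ∘ below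
        where
        below : (i : Fin (suc (rank d))) → ∃[ e ] P e × rank e ≡ toℕ i
        below i = rank-attained (suc (to d)) (subst (toℕ i <_) (sym (count-suc-code p)) (toℕ<n i))

        inj : Injective _≡_ _≡_ (proj₁ ∘ below)
        inj {i} {j} eq = toℕ-injective
          (trans (sym (proj₂ (proj₂ (below i)))) (trans (cong rank eq) (proj₂ (proj₂ (below j)))))

    open Rank

    -- Elements of equal rank are matched. Rank `r` occurs in a set exactly when the set has at
    -- least `suc r` elements, so both sets have the same ranks, whether they are finite or
    -- infinite.
    sameCardinality : {P Q : Pred D 0ℓ} → (∀ n → AtLeast n P ⇔ AtLeast n Q) →
      SameCardinality (SubsetOf (setoid D) P) (SubsetOf (setoid D) Q)
    sameCardinality {P} {Q} P⇔Q = record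
      { to        = λ (d , p) → proj₁ (match p) , matched p
      ; cong      = λ {(d , p)} {(d′ , p′)} d≡d′ → rank-injective Q (matched p) (matched p′)
                      (trans (same p) (trans (cong (rank P) d≡d′) (sym (same p′))))
      ; bijective =
          (λ {(d , p)} {(d′ , p′)} eq → rank-injective P p p′
            (trans (sym (same p)) (trans (cong (rank Q) eq) (same p′))))
        , λ (e , q) →
            let d , p , rank≡ = AtLeast⇒rank P (Equivalence.from (P⇔Q _) (rank⇒AtLeast Q q))
            in (d , p) , λ {(d′ , p′)} d′≡d → rank-injective Q (matched p′) q
                 (trans (same p′) (trans (cong (rank P) d′≡d) rank≡))
      }
      where
      match : ∀ {d} → P d → ∃[ e ] Q e × rank Q e ≡ rank P d
      match p = AtLeast⇒rank Q (Equivalence.to (P⇔Q _) (rank⇒AtLeast P p))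

      matched : ∀ {d} (p : P d) → Q (proj₁ (match p))
      matched p = proj₁ (proj₂ (match p))

      same : ∀ {d} (p : P d) → rank Q (proj₁ (match p)) ≡ rank P d
      same p = proj₂ (proj₂ (match p))

    ¬sameCardinality : {P Q : Pred D 0ℓ} →
      ¬ SameCardinality (SubsetOf (setoid D) P) (SubsetOf (setoid D) Q) →
      ∃[ n ] (AtLeast n P × ¬ AtLeast n Q ⊎ ¬ AtLeast n P × AtLeast n Q)
    ¬sameCardinality {P} {Q} P≁Q = byContradiction λ ¬∃ → P≁Q (sameCardinality λ n → mk⇔
      (λ p → byContradiction λ ¬q → ¬∃ (n , inj₁ (p , ¬q)))
      (λ q → byContradiction λ ¬p → ¬∃ (n , inj₂ (¬p , q))))

AtLeast-injection : {D E : Set} {P : Pred D 0ℓ} {Q : Pred E 0ℓ} {n : ℕ} →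
  Injection (SubsetOf (setoid D) P) (SubsetOf (setoid E) Q) → AtLeast n P → AtLeast n Q
AtLeast-injection f (w , w-inj , p) =
  (λ i → proj₁ (to (w i , p i))) , w-inj ∘ injective , λ i → proj₂ (to (w i , p i))
  where open Injection f using (to; injective)

AtLeast-surjection : {D E : Set} {P : Pred D 0ℓ} {Q : Pred E 0ℓ} {n : ℕ} →
  Surjection (SubsetOf (setoid D) P) (SubsetOf (setoid E) Q) → AtLeast n Q → AtLeast n P
AtLeast-surjection f (w , w-inj , q) =
    proj₁ ∘ preimage
  , (λ {i} {j} eq → w-inj (trans (sym (image i)) (trans (f-cong eq) (image j))))
  , proj₂ ∘ preimage
  where
  open Surjection f using (to; strictlySurjective) renaming (cong to f-cong)
  preimage = λ i → proj₁ (strictlySurjective (w i , q i))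
  image    = λ i → proj₂ (strictlySurjective (w i , q i))

-- Trees of uncountable sets

module _ (em : ExcludedMiddle 0ℓ) (A : Setoid 0ℓ 0ℓ) where
  open Classical em
  open Setoid A using (_≈_) renaming (Carrier to C)
  module A = Setoid A

  -- Countability without the requirement that the enumeration respect _≈_,
  -- so that it may depend on choices.
  Thin : Pred C 0ℓ → Set
  Thin S = Σ[ f ∈ (Σ C S → ℕ) ] (∀ {p q} → f p ≡ f q → proj₁ p ≈ proj₁ q)

  Large : Pred C 0ℓ → Set
  Large S = ¬ Thin S

  -- Taking the least name borne by any equal point makes the name independent of the representative
  -- and of the membership proof.
  thin⇒countable : ∀ {S} → Thin S → Countable (SubsetOf A S)
  thin⇒countable {S} (f , f-inj) = record
    { to        = proj₁ ∘ first
    ; cong      = λ {p} {q} p≈q → ≤-antisym (first-mono p≈q) (first-mono (A.sym p≈q))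
    ; injective = λ {p} {q} eq →
        let r , r≈p , fr = proj₁ (proj₂ (first p))
            s , s≈q , fs = proj₁ (proj₂ (first q))
        in A.trans (A.sym r≈p) (A.trans (f-inj (trans fr (trans eq (sym fs)))) s≈q)
    }
    where
    Name : Σ C S → Pred ℕ 0ℓ
    Name p n = ∃[ q ] proj₁ q ≈ proj₁ p × f q ≡ n

    first : ∀ p → ∃[ n ] Name p n × (∀ {m} → Name p m → n ≤ m)
    first p = least (Name p) (f p) (p , A.refl , refl)

    first-mono : ∀ {p q} → proj₁ p ≈ proj₁ q → proj₁ (first p) ≤ proj₁ (first q)
    first-mono {p} {q} p≈q =
      let r , r≈q , fr = proj₁ (proj₂ (first q))
      in proj₂ (proj₂ (first p)) (r , A.trans r≈q (A.sym p≈q) , fr)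

  thin-⊆ : ∀ {S R} → S ⊆ R → Thin R → Thin S
  thin-⊆ S⊆R (f , f-inj) = f ∘ map₂ S⊆R , f-inj

  thin-⋃ : {J : Set} → J ↣ ℕ → {R : J → Pred C 0ℓ} →
    (∀ j → Thin (R j)) → Thin (λ x → ∃[ j ] R j x)
  thin-⋃ code {R} thin = name , λ {p} {q} → name-injective {p} {q}
    where
    open Injection code using (to; injective)
    name : (Σ[ x ∈ C ] ∃[ j ] R j x) → ℕ
    name (x , j , r) = pair (to j) (proj₁ (thin j) (x , r))

    name-injective : ∀ {p q} → name p ≡ name q → proj₁ p ≈ proj₁ q
    name-injective {x , j , r} {y , k , s} eq with pair-injective eq
    ... | j≡k , eq′ with injective j≡k
    ...   | refl = proj₂ (thin j) eq′

  thin-∪ : ∀ {S R} → Thin S → Thin R → Thin (S ∪ R)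
  thin-∪ {S} {R} (f , f-inj) (g , g-inj) = name , λ {p} {q} → name-injective {p} {q}
    where
    name : Σ C (S ∪ R) → ℕ
    name (x , inj₁ s) = pair 0 (f (x , s))
    name (x , inj₂ r) = pair 1 (g (x , r))

    name-injective : ∀ {p q} → name p ≡ name q → proj₁ p ≈ proj₁ q
    name-injective {_ , inj₁ _} {_ , inj₁ _} eq = f-inj (proj₂ (pair-injective eq))
    name-injective {_ , inj₂ _} {_ , inj₂ _} eq = g-inj (proj₂ (pair-injective eq))
    name-injective {_ , inj₁ _} {_ , inj₂ _} eq = contradiction (proj₁ (pair-injective {0} {_} {1} eq)) λ ()
    name-injective {_ , inj₂ _} {_ , inj₁ _} eq = contradiction (proj₁ (pair-injective {1} {_} {0} eq)) λ ()

  large⇒inhabited : ∀ {S} → Large S → ∃ S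
  large⇒inhabited large = byContradiction λ empty →
    large ((λ _ → 0) , λ {p} → contradiction p empty)

  pigeonhole : {J : Set} → J ↣ ℕ → {S : Pred C 0ℓ} {R : J → Pred C 0ℓ} → Large S →
    (∀ {x} → S x → ∃[ j ] R j x) → ∃[ j ] Large (S ∩ R j)
  pigeonhole code large covers = byContradiction λ ¬∃ → large (thin-⊆
    (λ s → let j , r = covers s in j , s , r)
    (thin-⋃ code λ j → byContradiction λ l → ¬∃ (j , l)))

  Separates : Pred C 0ℓ → C → C → Set
  Separates B x y = B x × ¬ B y ⊎ ¬ B x × B y

  -- If no B k halved S, then removing for every k the thin side of B k would
  -- leave at most one point.
  halving : {K : Set} → K ↣ ℕ → (B : K → Pred C 0ℓ) {S : Pred C 0ℓ} → Large S →
    (∀ {x y} → S x → S y → ¬ x ≈ y → ∃[ k ] Separates (B k) x y) →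
    ∃[ k ] Large (S ∩ B k) × Large (S ∩ ∁ (B k))
  halving {K} code B {S} large separated = byContradiction λ ¬∃ →
    let side : ∀ k → Thin (S ∩ B k) ⊎ Thin (S ∩ ∁ (B k))
        side k = byContradiction λ ¬side → ¬∃ (k , ¬side ∘ inj₁ , ¬side ∘ inj₂)
    in large (halves side)
    where
    module _ (side : ∀ k → Thin (S ∩ B k) ⊎ Thin (S ∩ ∁ (B k))) where
      Minority : K → Pred C 0ℓ
      Minority k with side k
      ... | inj₁ _ = S ∩ B k
      ... | inj₂ _ = S ∩ ∁ (B k)

      minority-thin : ∀ k → Thin (Minority k)
      minority-thin k with side k
      ... | inj₁ thin = thin
      ... | inj₂ thin = thin

      minority-separated : ∀ {x y} k → S x → S y → Separates (B k) x y → Minority k x ⊎ Minority k y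
      minority-separated k s t sep with side k
      minority-separated k s t (inj₁ (b , _)) | inj₁ _ = inj₁ (s , b)
      minority-separated k s t (inj₂ (_ , b)) | inj₁ _ = inj₂ (t , b)
      minority-separated k s t (inj₁ (_ , b)) | inj₂ _ = inj₂ (t , b)
      minority-separated k s t (inj₂ (b , _)) | inj₂ _ = inj₁ (s , b)

      Rest : Pred C 0ℓ
      Rest x = S x × ¬ (∃[ k ] Minority k x)

      rest-thin : Thin Rest
      -- A constant name suffices: two different points would be separated by some `B k`, which puts
      -- one of them into the minority of `k`.
      rest-thin = (λ _ → 0) , λ {(x , s , ¬m)} {(y , t , ¬n)} _ → byContradiction λ x≉y →
        let k , sep = separated s t x≉y
        in [ ¬m ∘ (k ,_) , ¬n ∘ (k ,_) ]′ (minority-separated k s t sep)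

      halves : Thin S
      halves = thin-⊆ cover (thin-∪ rest-thin (thin-⋃ code minority-thin))
        where
        cover : S ⊆ (Rest ∪ (λ x → ∃[ k ] Minority k x))
        cover {x} s with em {∃[ k ] Minority k x}
        ... | yes m = inj₂ m
        ... | no ¬m = inj₁ (s , ¬m)

  -- `Req n j` is to be read as "question `n` has answer `j`", and `B k w` as "`w` witnesses
  -- statement `k`".
  module Scheme
    (Req : ℕ → ℕ → Pred C 0ℓ) (covers : ∀ n x → ∃[ j ] Req n j x)
    {K : Set} (K↣ℕ : K ↣ ℕ)
    {W : K → Set} (W↣ℕ : ∀ k → W k ↣ ℕ) (B : ∀ k → W k → Pred C 0ℓ)
    (S : Pred C 0ℓ) (S-large : Large S)
    (separated : ∀ {x y} → S x → S y → ¬ x ≈ y →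
      ∃[ k ] Separates (λ z → ∃[ w ] B k w z) x y)
    where

    ⋃B : K → Pred C 0ℓ
    ⋃B k x = ∃[ w ] B k w x

    record Node : Set₁ where
      field
        points  : Pred C 0ℓ
        inside  : points ⊆ S
        isLarge : Large points
    open Node

    -- Only `holds` fixes a witness: the failure of statement `key` is universal in the witnesses
    -- and leaves nothing to choose.
    record Split (n : ℕ) (N : Node) : Set where
      field
        piece   : ℕ
        key     : K
        witness : W key
        holds   : Large (((points N ∩ Req n piece) ∩ ⋃B key) ∩ B key witness)
        fails   : Large ((points N ∩ Req n piece) ∩ ∁ (⋃B key))
    open Split

    abstract
      split : ∀ n N → Split n N
      split n N =
        let j , large            = pigeonhole (↣-id ℕ) (isLarge N) (λ {x} _ → covers n x)
            k , largeʰ , largeᶠ  = halving K↣ℕ ⋃B large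
                                     (λ (x∈N , _) (y∈N , _) → separated (inside N x∈N) (inside N y∈N))
            w , largeʷ           = pigeonhole (W↣ℕ k) largeʰ proj₂
        in record { piece = j ; key = k ; witness = w ; holds = largeʷ ; fails = largeᶠ }

    child : ℕ → Bool → Node → Node
    child n true  N = record
      { inside = λ (((x∈N , _) , _) , _) → inside N x∈N ; isLarge = holds (split n N) }
    child n false N = record
      { inside = λ ((x∈N , _) , _) → inside N x∈N ; isLarge = fails (split n N) }

    child-⊆ : ∀ n c N → points (child n c N) ⊆ points N
    child-⊆ n true  N (((x∈N , _) , _) , _) = x∈N
    child-⊆ n false N ((x∈N , _) , _)       = x∈N

    child-Req : ∀ n c N → points (child n c N) ⊆ Req n (piece (split n N))
    child-Req n true  N (((_ , r) , _) , _) = r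
    child-Req n false N ((_ , r) , _)       = r

    branch : (ℕ → Bool) → ℕ → Node
    branch b zero    = record { inside = λ s → s ; isLarge = S-large }
    branch b (suc n) = child n (b n) (branch b n)

    -- The nodes themselves coincide, not just their points. Since `split` chooses from the node,
    -- both branches then face the same choice at level `n`.
    branch-cong : ∀ {b c} n → (∀ {m} → m < n → b m ≡ c m) → branch b n ≡ branch c n
    branch-cong zero    _   = refl
    branch-cong (suc n) b≡c = cong₂ (child n) (b≡c ≤-refl) (branch-cong n (b≡c ∘ m<n⇒m<1+n))

    branch-antitone : ∀ b {m n} → m ≤ n → points (branch b n) ⊆ points (branch b m)
    branch-antitone b {n = zero}      z≤n = λ x∈ → x∈
    branch-antitone b {m} {n = suc n} m≤1+n with m ≟ suc n
    ... | yes refl = λ x∈ → x∈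
    ... | no  m≢   = branch-antitone b (s≤s⁻¹ (≤∧≢⇒< m≤1+n m≢)) ∘ child-⊆ n (b n) (branch b n)

    branch-Req : ∀ b n → ∃[ j ] points (branch b (suc n)) ⊆ Req n j
    branch-Req b n = piece (split n (branch b n)) , child-Req n (b n) (branch b n)

    -- `M` and `M′` are variables so that nodes known only by an equation to be the two children can
    -- be matched with `refl`.
    child-separated : ∀ n N {M M′} → M ≡ child n true N → M′ ≡ child n false N →
      ∃[ k ] (∃[ w ] points M ⊆ B k w) × points M′ ⊆ ∁ (⋃B k)
    child-separated n N refl refl =
      key (split n N) , (witness (split n N) , proj₂) , proj₂

    branch-separated : ∀ {b c} n → (∀ {m} → m < n → b m ≡ c m) → b n ≡ true → c n ≡ false →
      ∃[ k ] (∃[ w ] points (branch b (suc n)) ⊆ B k w)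
           × points (branch c (suc n)) ⊆ ∁ (⋃B k)
    branch-separated {c = c} n b≡c bn cn = child-separated n (branch c n)
      (cong₂ (child n) bn (branch-cong n b≡c)) (cong (λ d → child n d (branch c n)) cn)

-- Isomorphism and satisfaction

Vec-map-injective : {A B : Set} {f : A → B} → Injective _≡_ _≡_ f →
  ∀ {n} → Injective _≡_ _≡_ (map {n = n} f)
Vec-map-injective f-inj {x = []}    {[]}    _  = refl
Vec-map-injective f-inj {x = _ ∷ _} {_ ∷ _} eq =
  let p , q = ∷-injective eq in cong₂ _∷_ (f-inj p) (Vec-map-injective f-inj q)

map-agree : ∀ {n} (us : Vec Var n) {f : ℕ → ℕ} {σ τ : Assignment} →
  (∀ v → v Vec.∈ us → f (σ v) ≡ τ v) → map f (map σ us) ≡ map τ us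
map-agree []       _     = refl
map-agree (u ∷ us) agree =
  cong₂ _∷_ (agree u (here refl)) (map-agree us λ v v∈us → agree v (there v∈us))

-- Restricted to listed variables, because elsewhere `assign` gives 0, which `f` may move.
assign-map : ∀ (f : ℕ → ℕ) vs s {v} → v List.∈ vs → f (assign vs s v) ≡ assign vs (map f s) v
assign-map f (u ∷ vs) (a ∷ s) {v} v∈ with v ≟ u
... | yes _ = refl
assign-map f (u ∷ vs) (a ∷ s) (Any.here v≡u)   | no v≢u = contradiction v≡u v≢u
assign-map f (u ∷ vs) (a ∷ s) (Any.there v∈vs) | no _   = assign-map f vs s v∈vs

-- Lists are countably many, unlike all assignments, and suffice for formulas with finitely many
-- free variables.
nth : List ℕ → Assignment
nth []      _       = 0
nth (a ∷ l) zero    = a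
nth (a ∷ l) (suc v) = nth l v

nth-applyUpTo : ∀ (σ : Assignment) {N v} → v < N → nth (applyUpTo σ N) v ≡ σ v
nth-applyUpTo σ {suc N} {zero}  _   = refl
nth-applyUpTo σ {suc N} {suc v} v<N = nth-applyUpTo (σ ∘ suc) (s≤s⁻¹ v<N)

module _ {L : Language} where

  Agree : (ℕ → ℕ) → Formula L → Assignment → Assignment → Set
  Agree f φ σ τ = ∀ v → v FreeIn φ → f (σ v) ≡ τ v

  agree-[↦] : ∀ f {σ τ v a b} (φ : Formula L) → (∀ u → u ≢ v × u FreeIn φ → f (σ u) ≡ τ u) →
    f a ≡ b → Agree f φ (σ [ v ↦ a ]) (τ [ v ↦ b ])
  agree-[↦] _ {v = v} φ agree fa≡b u u∈φ with u ≟ v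
  ... | yes _  = fa≡b
  ... | no u≢v = agree u (u≢v , u∈φ)

  module _ {x y : X L} (x≅y : x ≅ y) where
    open Bijection (proj₁ x≅y) using (to; injective; strictlySurjective)

    -- Equality uses that `to` is injective, the quantifiers that it is surjective. As agreement is
    -- required on free variables only, the identity isomorphism yields `coincidence`.
    ⊨-iso : ∀ φ {σ τ} → Agree to φ σ τ → (x , σ ⊨ φ) ⇔ (y , τ ⊨ φ)
    ⊨-iso (u ≐ v) agree =
      let p = agree u (inj₁ refl) ; q = agree v (inj₂ refl)
      in mk⇔ (λ e → trans (sym p) (trans (cong to e) q)) (λ e → injective (trans p (trans e (sym q))))
    ⊨-iso (rel i us) {σ} {τ} agree = mk⇔ (trans (sym eq)) (trans eq)
      where
      eq : x i (map σ us) ≡ y i (map τ us)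
      eq = trans (proj₂ x≅y i _) (cong (y i) (map-agree us agree))
    ⊨-iso (¬′ φ) agree = mk⇔ (_∘ E.from (⊨-iso φ agree)) (_∘ E.to (⊨-iso φ agree))
    ⊨-iso (φ ∧′ ψ) agree =
      let p = ⊨-iso φ (λ v → agree v ∘ inj₁) ; q = ⊨-iso ψ (λ v → agree v ∘ inj₂)
      in mk⇔ (Product.map (E.to p) (E.to q)) (Product.map (E.from p) (E.from q))
    ⊨-iso (φ ∨′ ψ) agree =
      let p = ⊨-iso φ (λ v → agree v ∘ inj₁) ; q = ⊨-iso ψ (λ v → agree v ∘ inj₂)
      in mk⇔ (Sum.map (E.to p) (E.to q)) (Sum.map (E.from p) (E.from q))
    ⊨-iso (⋀ Φ) agree =
      let p = λ n → ⊨-iso (Φ n) (λ v → agree v ∘ (n ,_))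
      in mk⇔ (λ h n → E.to (p n) (h n)) (λ h n → E.from (p n) (h n))
    ⊨-iso (⋁ Φ) agree =
      let p = λ n → ⊨-iso (Φ n) (λ v → agree v ∘ (n ,_))
      in mk⇔ (map₂ λ {n} → E.to (p n)) (map₂ λ {n} → E.from (p n))
    ⊨-iso (∀′ v φ) agree = mk⇔
      (λ h b → let a , fa≡b = strictlySurjective b in E.to (⊨-iso φ (agree-[↦] to φ agree fa≡b)) (h a))
      (λ h a → E.from (⊨-iso φ (agree-[↦] to φ agree refl)) (h (to a)))
    ⊨-iso (∃′ v φ) agree = mk⇔
      (λ (a , h) → to a , E.to (⊨-iso φ (agree-[↦] to φ agree refl)) h)
      (λ (b , h) → let a , fa≡b = strictlySurjective b in a , E.from (⊨-iso φ (agree-[↦] to φ agree fa≡b)) h)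

    ≅⇒sameCardinality : ∀ φ (fv : FreeVariables φ) →
      SameCardinality (DefinableSet φ fv x) (DefinableSet φ fv y)
    ≅⇒sameCardinality φ fv = record
      { to        = λ (s , h) → map to s , E.to (⊨-iso φ (agree s)) h
      ; cong      = cong (map to)
      ; bijective = Vec-map-injective injective , λ (t , h) →
          (map from t , E.from (⊨-iso φ (agree (map from t))) (subst (Definable φ fv y) (sym (to-from t)) h))
        , λ eq → trans (cong (map to) eq) (to-from t)
      }
      where
      agree : ∀ s → Agree to φ (assign (Δ fv) s) (assign (Δ fv) (map to s))
      agree s v v∈φ = assign-map to (Δ fv) s (E.from (complete fv v) v∈φ)

      from : ℕ → ℕ
      from b = proj₁ (strictlySurjective b)

      to-from : ∀ {n} (t : Vec ℕ n) → map to (map from t) ≡ t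
      to-from []      = refl
      to-from (b ∷ t) = cong₂ _∷_ (proj₂ (strictlySurjective b)) (to-from t)

  separable⇒≇ : ∀ {F : Pred (Formula L) 0ℓ} {x y} → Separable F x y → ¬ (x ≅ y)
  separable⇒≇ (φ , _ , fv , ¬same) x≅y = ¬same (≅⇒sameCardinality x≅y φ fv)

  ≈⇒≅ : ∀ {x y : X L} → Setoid._≈_ (X-setoid L) x y → x ≅ y
  ≈⇒≅ {x} {y} x≈y = ⤖-id ℕ , λ i s → trans (x≈y i s) (cong (y i) (sym (map-id s)))

  ≅-refl : ∀ {x : X L} → x ≅ x
  ≅-refl {x} = ≈⇒≅ {x} (λ _ _ → refl)

  separable-resp-≅ : ∀ {F : Pred (Formula L) 0ℓ} {x x′ y y′} → x ≅ x′ → y′ ≅ y →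
    Separable F x y → Separable F x′ y′
  separable-resp-≅ x≅x′ y′≅y (φ , φ∈F , fv , ¬same) = φ , φ∈F , fv , λ same → ¬same
    (Composition.bijection (≅⇒sameCardinality x≅x′ φ fv)
      (Composition.bijection same (≅⇒sameCardinality y′≅y φ fv)))

  coincidence : ∀ {x : X L} φ {σ τ} → Agree id φ σ τ → (x , σ ⊨ φ) ⇔ (x , τ ⊨ φ)
  coincidence = ⊨-iso ≅-refl

  -- The statements whose truth values determine that of φ in a generic model:
  -- the atomic ones themselves, the conjuncts of a conjunction, and the
  -- negated disjuncts of a disjunction, quantifiers included.
  Instances : Formula L → Assignment → ℕ → Pred (X L) 0ℓ
  Instances (rel i us) σ _ x = x , σ ⊨ rel i us
  Instances (⋀ Φ)      σ n x = x , σ ⊨ Φ n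
  Instances (⋁ Φ)      σ n x = ¬ (x , σ ⊨ Φ n)
  Instances (∀′ v φ)   σ a x = x , σ [ v ↦ a ] ⊨ φ
  Instances (∃′ v φ)   σ a x = ¬ (x , σ [ v ↦ a ] ⊨ φ)
  Instances _          _ _ _ = ⊤

  ¬-⇔ : {P Q : Set} → P ⇔ Q → (¬ P) ⇔ (¬ Q)
  ¬-⇔ p = mk⇔ (_∘ E.from p) (_∘ E.to p)

  instances-coincide : ∀ φ {σ τ} → Agree id φ σ τ → ∀ a {x} → Instances φ σ a x ⇔ Instances φ τ a x
  instances-coincide (rel i us) agree _ {x} = coincidence {x} (rel i us) agree
  instances-coincide (⋀ Φ)      agree n = coincidence (Φ n) (λ v → agree v ∘ (n ,_))
  instances-coincide (⋁ Φ)      agree n = ¬-⇔ (coincidence (Φ n) (λ v → agree v ∘ (n ,_)))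
  instances-coincide (∀′ v φ)   agree a = coincidence φ (agree-[↦] id φ agree refl)
  instances-coincide (∃′ v φ)   agree a = ¬-⇔ (coincidence φ (agree-[↦] id φ agree refl))
  instances-coincide (_ ≐ _)    _     _ = ⇔-id ⊤
  instances-coincide (¬′ _)     _     _ = ⇔-id ⊤
  instances-coincide (_ ∧′ _)   _     _ = ⇔-id ⊤
  instances-coincide (_ ∨′ _)   _     _ = ⇔-id ⊤

  -- Index 0 says that all instances hold, `suc a` that `a` is a counterexample. For disjunctions
  -- and existential formulas, whose instances are negated, such an `a` is a witness up to double
  -- negation.
  Piece : (ℕ → Pred (X L) 0ℓ) → ℕ → Pred (X L) 0ℓ
  Piece I zero    x = ∀ a → I a x
  Piece I (suc a) x = ¬ I a x

  piece-⊆ : ∀ {I J : ℕ → Pred (X L) 0ℓ} → (∀ a {x} → I a x ⇔ J a x) → ∀ j → Piece I j ⊆ Piece J j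
  piece-⊆ I⇔J zero    h a = E.to (I⇔J a) (h a)
  piece-⊆ I⇔J (suc a) h   = h ∘ E.from (I⇔J a)

  firstOrder⊆fragment : ∀ {F : Pred (Formula L) 0ℓ} → IsFragment F → ∀ {φ} → FirstOrder φ → φ ∈ F
  firstOrder⊆fragment {F} isFragment = go
    where
    open IsFragment isFragment
    go : FirstOrder ⊆ F
    go (atomic a) = atomics a
    go (¬′ p)     = ¬-closed (go p)
    go (p ∧′ q)   = ∧-closed (go p) (go q)
    go (p ∨′ q)   = ∨-closed (go p) (go q)
    go (∀′ v p)   = ∀-closed v (go p)
    go (∃′ v p)   = ∃-closed v (go p)

-- The limit of a generic sequence of sets of structures

module Limit (em : ExcludedMiddle 0ℓ) {L : Language}
  (F : Pred (Formula L) 0ℓ) (isFragment : IsFragment F)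
  (G : ℕ → Pred (X L) 0ℓ)
  (antitone : ∀ {m n} → m ≤ n → G n ⊆ G m) (inhabited : ∀ n → ∃ (G n))
  (decided : ∀ {φ} → φ ∈ F → ∀ l → ∃[ n ] ∃[ j ] G n ⊆ Piece (Instances φ (nth l)) j)
  where
  open IsFragment isFragment
  open Classical em

  Forced : Pred (X L) 0ℓ → Set
  Forced P = ∃[ n ] G n ⊆ P

  forced-⊆ : ∀ {P Q} → P ⊆ Q → Forced P → Forced Q
  forced-⊆ P⊆Q (n , h) = n , P⊆Q ∘ h

  forced-∩ : ∀ {P Q} → Forced P → Forced Q → Forced (P ∩ Q)
  forced-∩ (m , p) (n , q) = m ⊔ n , λ g → p (antitone (m≤m⊔n m n) g) , q (antitone (m≤n⊔m m n) g)

  forced-universal : ∀ {P} → (∀ x → P x) → Forced P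
  forced-universal p = 0 , λ {x} _ → p x

  -- Finitely many levels have a common upper bound. Infinitely many need not, so infinite
  -- conjunctions go through `Piece` instead.
  forced-⋂ : ∀ {n} {P : Fin n → Pred (X L) 0ℓ} → (∀ i → Forced (P i)) → Forced (λ x → ∀ i → P i x)
  forced-⋂ {zero}  _ = forced-universal λ _ ()
  forced-⋂ {suc n} p = forced-⊆ (λ { (p₀ , _) zero → p₀ ; (_ , ps) (suc i) → ps i })
    (forced-∩ (p zero) (forced-⋂ (p ∘ suc)))

  forced⇒inhabited : ∀ {P} → Forced P → ∃ P
  forced⇒inhabited (n , h) = map₂ h (inhabited n)

  limit : X L
  limit i s = does (em {Forced (λ x → x i s ≡ true)})

  forced-piece : ∀ {φ} → φ ∈ F → ∀ σ → ∃[ j ] Forced (Piece (Instances φ σ) j)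
  forced-piece {φ} φ∈F σ = let n , j , h = decided φ∈F l in
    j , n , piece-⊆ (instances-coincide φ agree) j ∘ h
    where
    fv = formulas φ∈F
    -- With `suc`, the largest free variable is still a position of `l`.
    N  = suc (max 0 (Δ fv))
    l  = applyUpTo σ N

    agree : Agree id φ (nth l) σ
    agree v v∈φ = nth-applyUpTo σ
      (s≤s (All.lookup (xs≤max 0 (Δ fv)) (E.from (complete fv v) v∈φ)))

  -- The induction in `truth` carries two claims at once: the sequence decides `P`, and the limit
  -- obeys the decision. Negation then swaps the two cases.
  Transfers : Pred (X L) 0ℓ → Set
  Transfers P = Forced P × P limit ⊎ Forced (∁ P) × ¬ P limit

  transfers-∁ : ∀ {P} → Transfers P → Transfers (∁ P)
  transfers-∁ (inj₁ (f , p)) = inj₂ (forced-⊆ contradiction f , contradiction p)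
  transfers-∁ (inj₂ (f , p)) = inj₁ (f , p)

  -- As every `G n` is inhabited, no statement is forced together with its negation.
  transfers-true : ∀ {P} → Transfers P → Forced P → P limit
  transfers-true (inj₁ (_ , p)) _ = p
  transfers-true (inj₂ (f , _)) g = let _ , ¬p , p = forced⇒inhabited (forced-∩ f g) in contradiction p ¬p

  transfers-false : ∀ {P} → Transfers P → Forced (∁ P) → ¬ P limit
  transfers-false t = transfers-true (transfers-∁ t)

  forced-true : ∀ {P} → Transfers P → P limit → Forced P
  forced-true (inj₁ (f , _)) _ = f
  forced-true (inj₂ (_ , ¬p)) p = contradiction p ¬p

  -- The forced piece gives either a single level at which all conjuncts hold or one fixed conjunct
  -- that fails from some level on.
  transfers-⋂ : ∀ {P : ℕ → Pred (X L) 0ℓ} → ∃[ j ] Forced (Piece P j) → (∀ a → Transfers (P a)) →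
    Transfers (λ x → ∀ a → P a x)
  transfers-⋂ (zero  , f) t = inj₁ (f , λ a → transfers-true (t a) (forced-⊆ (λ h → h a) f))
  transfers-⋂ (suc a , f) t = inj₂ (forced-⊆ (λ ¬p p → ¬p (p a)) f , λ p → transfers-false (t a) f (p a))

  transfers-⋃ : ∀ {P : ℕ → Pred (X L) 0ℓ} → ∃[ j ] Forced (Piece (λ a → ∁ (P a)) j) →
    (∀ a → Transfers (P a)) → Transfers (λ x → ∃[ a ] P a x)
  transfers-⋃ (zero  , f) t = inj₂
    (forced-⊆ (λ ¬p (a , p) → ¬p a p) f , λ (a , p) → transfers-false (t a) (forced-⊆ (λ ¬p → ¬p a) f) p)
  transfers-⋃ (suc a , f) t =
    -- The piece `suc a` only denies the negation of `P a`.
    let g = forced-⊆ byContradiction f in inj₁ (forced-⊆ (a ,_) g , a , transfers-true (t a) g)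

  -- The truth lemma of a Henkin construction, by induction on the formula within the fragment.
  truth : ∀ φ → φ ∈ F → ∀ σ → Transfers (λ x → x , σ ⊨ φ)
  truth (u ≐ v) _ σ with σ u ≟ σ v
  ... | yes eq = inj₁ (forced-universal (λ _ → eq) , eq)
  ... | no  ne = inj₂ (forced-universal (λ _ → ne) , ne)
  -- `limit` is defined by this instance of `em`, so matching on it computes the truth value. The
  -- instances of an atomic formula do not depend on their index, so any index serves below.
  truth (rel i us) φ∈F σ with em {Forced (λ x → x i (map σ us) ≡ true)} | forced-piece φ∈F σ
  ... | yes f | _         = inj₁ (f , refl)
  ... | no ¬f | zero  , g = contradiction (forced-⊆ (λ h → h 0) g) ¬f
  ... | no ¬f | suc _ , g = inj₂ (g , λ p → contradiction p λ ())
  truth (¬′ φ) φ∈F σ = transfers-∁ (truth φ (subformulas (¬-sub ◅ ε) φ∈F) σ)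
  truth (φ ∧′ ψ) φ∈F σ
    with truth φ (subformulas (∧-subˡ ◅ ε) φ∈F) σ | truth ψ (subformulas (∧-subʳ ◅ ε) φ∈F) σ
  ... | inj₁ (f , p) | inj₁ (g , q) = inj₁ (forced-∩ f g , p , q)
  ... | inj₂ (f , p) | _            = inj₂ (forced-⊆ (_∘ proj₁) f , p ∘ proj₁)
  ... | inj₁ _       | inj₂ (g , q) = inj₂ (forced-⊆ (_∘ proj₂) g , q ∘ proj₂)
  truth (φ ∨′ ψ) φ∈F σ
    with truth φ (subformulas (∨-subˡ ◅ ε) φ∈F) σ | truth ψ (subformulas (∨-subʳ ◅ ε) φ∈F) σ
  ... | inj₁ (f , p) | _            = inj₁ (forced-⊆ inj₁ f , inj₁ p)
  ... | inj₂ _       | inj₁ (g , q) = inj₁ (forced-⊆ inj₂ g , inj₂ q)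
  ... | inj₂ (f , p) | inj₂ (g , q) = inj₂ (forced-⊆ (λ (¬p , ¬q) → [ ¬p , ¬q ]′) (forced-∩ f g) , [ p , q ]′)
  truth (⋀ Φ)    φ∈F σ = transfers-⋂ (forced-piece φ∈F σ) λ n → truth (Φ n) (subformulas (⋀-sub n ◅ ε) φ∈F) σ
  truth (⋁ Φ)    φ∈F σ = transfers-⋃ (forced-piece φ∈F σ) λ n → truth (Φ n) (subformulas (⋁-sub n ◅ ε) φ∈F) σ
  truth (∀′ v φ) φ∈F σ = transfers-⋂ (forced-piece φ∈F σ) λ a → truth φ (subformulas (∀-sub ◅ ε) φ∈F) _
  truth (∃′ v φ) φ∈F σ = transfers-⋃ (forced-piece φ∈F σ) λ a → truth φ (subformulas (∃-sub ◅ ε) φ∈F) _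

-- The tree of models

module _ (em : ExcludedMiddle 0ℓ) {L : Language}
  {T : Pred (Formula L) 0ℓ} (isTheory : IsFirstOrderTheory T)
  {F : Pred (Formula L) 0ℓ} (isFragment : IsFragment F) (F-countable : CountableFormulas F)
  {S : Pred (X L) 0ℓ} (models : SetOfModels T S)
  (uncountable : ¬ Countable (SubsetOf (X-setoid L) S)) (separable : Pairwise (Separable F) S)
  where
  open Classical em

  _≈_ : X L → X L → Set
  _≈_ = Setoid._≈_ (X-setoid L)

  Question : Set
  Question = (Σ[ φ ∈ Formula L ] ∥ φ ∈ F ∥) × List ℕ

  Question-countable : Question ↣ ℕ
  Question-countable = ×-countable (squash-countable F-countable) List-countable

  Answer : Maybe Question → ℕ → Pred (X L) 0ℓ
  -- Levels whose number codes no question impose nothing.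
  Answer nothing              _ _ = ⊤
  Answer (just ((φ , _) , l)) j   = Piece (Instances φ (nth l)) j

  piece-covers : ∀ (I : ℕ → Pred (X L) 0ℓ) x → ∃[ j ] Piece I j x
  piece-covers I x with em {∃[ a ] ¬ I a x}
  ... | yes (a , ¬i) = suc a , ¬i
  ... | no  ¬∃       = 0 , λ a → byContradiction λ ¬i → ¬∃ (a , ¬i)

  answer-covers : ∀ q x → ∃[ j ] Answer q j x
  answer-covers nothing              _ = 0 , tt
  answer-covers (just ((φ , _) , l)) x = piece-covers (Instances φ (nth l)) x

  -- vs stands for the record fv, which can have different proofs for the same φ
  -- and so has no code.
  Definition : Pred (Formula L × List Var) 0ℓ
  Definition (φ , vs) = φ ∈ F × Σ[ fv ∈ FreeVariables φ ] Δ fv ≡ vs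

  Definition-countable : Countable (SubsetOf (setoid (Formula L × List Var)) Definition)
  Definition-countable = record
    { to        = λ ((φ , vs) , φ∈F , _) → pair (F.to (φ , φ∈F)) (Vars.to vs)
    ; cong      = λ { {(φ , vs) , φ∈F , _} {(.φ , .vs) , φ∈F′ , _} refl →
                        cong (λ c → pair c (Vars.to vs)) (F.cong {φ , φ∈F} {φ , φ∈F′} refl) }
    ; injective = λ eq → let p , q = pair-injective eq in cong₂ _,_ (F.injective p) (Vars.injective q)
    }
    where
    module F    = Injection F-countable
    module Vars = Injection List-countable

  Key : Set
  Key = (Σ[ d ∈ Formula L × List Var ] ∥ Definition d ∥) × ℕ

  Solutions : Formula L → (vs : List Var) → X L → Pred (Vec ℕ (length vs)) 0ℓ
  Solutions φ vs x s = x , assign vs s ⊨ φ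

  -- Vectors replace the functions from `Fin n` in `AtLeast`, because a code of their entries is
  -- injective for `_≡_`.
  Witness : Key → Set
  Witness (((_ , vs) , _) , n) = Vec (Vec ℕ (length vs)) n

  Witness-countable : ∀ k → Witness k ↣ ℕ
  Witness-countable (((_ , vs) , _) , n) = Vec-countable (Vec-countable (↣-id ℕ) (length vs)) n

  Witnessed : ∀ k → Witness k → Pred (X L) 0ℓ
  Witnessed (((φ , vs) , _) , n) w x = Injective _≡_ _≡_ (lookup w) × (∀ i → Solutions φ vs x (lookup w i))

  ManySolutions : Key → Pred (X L) 0ℓ
  ManySolutions k x = ∃[ w ] Witnessed k w x

  atLeast : ∀ φ vs d n {x} → ManySolutions (((φ , vs) , d) , n) x ⇔ AtLeast n (Solutions φ vs x)
  atLeast φ vs d n {x} = mk⇔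
    (λ (w , w-inj , sol) → lookup w , w-inj , sol)
    (λ (w , w-inj , sol) → tabulate w
      , (λ {i} {j} eq → w-inj (trans (sym (lookup∘tabulate w i)) (trans eq (lookup∘tabulate w j))))
      , λ i → subst (Solutions φ vs x) (sym (lookup∘tabulate w i)) (sol i))

  separated : ∀ {x y} → x ∈ S → y ∈ S → ¬ x ≈ y → ∃[ k ] Separates em (X-setoid L) (ManySolutions k) x y
  separated x∈S y∈S x≉y =
    let φ , φ∈F , fv , ¬same = separable x∈S y∈S x≉y
        n , sep              = Cardinality.¬sameCardinality (Vec-countable (↣-id ℕ) _) ¬same
        d                    = fromWitness (φ∈F , fv , refl)
        from                 = λ {x} → E.from (atLeast φ (Δ fv) d n {x})
        to                   = λ {x} → E.to (atLeast φ (Δ fv) d n {x})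
    in (((φ , Δ fv) , d) , n) , Sum.map (Product.map from (_∘ to)) (Product.map (_∘ to) from) sep

  open Scheme em (X-setoid L)
    (Answer ∘ decode Question-countable) (answer-covers ∘ decode Question-countable)
    (×-countable (squash-countable Definition-countable) (↣-id ℕ))
    Witness-countable Witnessed
    S (uncountable ∘ thin⇒countable em (X-setoid L)) separated
  open Node

  G : (ℕ → Bool) → ℕ → Pred (X L) 0ℓ
  G b n = points (branch b n)

  decided : ∀ b {φ} → φ ∈ F → ∀ l → ∃[ n ] ∃[ j ] G b n ⊆ Piece (Instances φ (nth l)) j
  -- The question with code `n` is answered in passing from level `n` to level `suc n`.
  decided b {φ} φ∈F l = suc n , j , λ {x} x∈G →
    subst (λ a → Answer a j x) (decode-code Question-countable q) (answer x∈G)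
    where
    q : Question
    q = (φ , fromWitness φ∈F) , l

    n = Injection.to Question-countable q
    j = proj₁ (branch-Req b n)
    answer : G b (suc n) ⊆ Answer (decode Question-countable n) j
    answer = proj₂ (branch-Req b n)

  -- The models given by the branches

  module Lim (b : ℕ → Bool) = Limit em F isFragment (G b) (branch-antitone b)
    (λ n → large⇒inhabited em (X-setoid L) (isLarge (branch b n))) (decided b)
  open Lim using (limit)

  -- `b` and `c` need only agree pointwise, but every node depends on finitely many bits, so both
  -- branches have equal nodes and force the same statements.
  limit-cong : ∀ {b c} → (∀ n → b n ≡ c n) → limit b ≈ limit c
  limit-cong {b} {c} b≗c i s = does-⇔ (mk⇔ (forced b≗c) (forced (sym ∘ b≗c))) em em
    where
    forced : ∀ {b c} → (∀ n → b n ≡ c n) →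
      Lim.Forced b (λ x → x i s ≡ true) → Lim.Forced c (λ x → x i s ≡ true)
    forced b≗c (n , h) = n , λ {x} → h ∘ subst (λ N → points N x) (sym (branch-cong n λ {m} _ → b≗c m))

  limit-models : ∀ b → limit b ⊨ᵀ T
  limit-models b φ∈T σ = Lim.transfers-true b
    (Lim.truth b _ (firstOrder⊆fragment isFragment (proj₁ (isTheory φ∈T))) σ)
    -- The root of the tree is `S`, so `T` is forced at level 0.
    (0 , λ x∈S → models x∈S φ∈T σ)

  module _ (b : ℕ → Bool) (k : Key) where
    open Lim b using
      (Forced; forced-⊆; forced-∩; forced-⋂; forced-true; forced⇒inhabited; transfers-true; truth)

    private
      φ = proj₁ (proj₁ (proj₁ k))
      φ∈F : φ ∈ F
      φ∈F = proj₁ (toWitness (proj₂ (proj₁ k)))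

    limit-witnessed : ∀ w → Forced (Witnessed k w) → Witnessed k w (limit b)
    -- That the entries of `w` are distinct does not involve the structure, so it can be read off at
    -- any point of the node.
    limit-witnessed w f = proj₁ (proj₂ (forced⇒inhabited f)) , λ i →
      transfers-true (truth φ φ∈F _) (forced-⊆ (λ (_ , sol) → sol i) f)

    -- A witness in the limit consists of finitely many true facts, which are forced together. It
    -- would therefore be a witness at some point where there is none.
    limit-unwitnessed : Forced (∁ (ManySolutions k)) → ¬ ManySolutions k (limit b)
    limit-unwitnessed f (w , w-inj , sol) =
      let g         = forced-⋂ (λ i → forced-true (truth φ φ∈F _) (sol i))
          _ , ¬w , h = forced⇒inhabited (forced-∩ f g)
      in ¬w (w , w-inj , h)

  fork : ∀ {b c} n → (∀ {m} → m < n → b m ≡ c m) → b n ≡ true → c n ≡ false →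
    ∃[ k ] ManySolutions k (limit b) × ¬ ManySolutions k (limit c)
  fork {b} {c} n b≡c bn cn =
    let k , (w , f) , g = branch-separated n b≡c bn cn
    in k , (w , limit-witnessed b k w (suc n , f)) , limit-unwitnessed c k (suc n , g)

  separates⇒separable : ∀ k {x y} → Separates em (X-setoid L) (ManySolutions k) x y → Separable F x y
  separates⇒separable (((φ , vs) , d) , n) {x} {y} sep with toWitness d
  ... | φ∈F , fv , refl = φ , φ∈F , fv , λ same →
    let to   = λ {x} → E.to (atLeast φ vs d n {x})
        from = λ {x} → E.from (atLeast φ vs d n {x})
    in [ (λ (p , ¬q) → ¬q (from (AtLeast-injection (Bijection.injection same) (to p))))
       , (λ (¬p , q) → ¬p (from (AtLeast-surjection (Bijection.surjection same) (to q)))) ]′ sep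

  limit-separable : ∀ {b c} → ¬ (∀ n → b n ≡ c n) → Separable F (limit b) (limit c)
  limit-separable {b} {c} b≢c with byContradiction (λ ¬∃ → b≢c (λ n → byContradiction (λ ne → ¬∃ (n , ne))))
  -- The first difference is taken, because `fork` requires agreement below `n`.
  ... | m , bm≢cm with least (λ n → b n ≢ c n) m bm≢cm
  ... | n , bn≢cn , n-least = go (b n) (c n) refl refl
    where
    b≡c : ∀ {m} → m < n → b m ≡ c m
    b≡c m<n = byContradiction λ ne → contradiction (n-least ne) (<⇒≱ m<n)

    go : ∀ s t → b n ≡ s → c n ≡ t → Separable F (limit b) (limit c)
    go true  false bn cn = let k , p , q = fork n b≡c bn cn in separates⇒separable k (inj₁ (p , q))
    go false true  bn cn = let k , p , q = fork n (sym ∘ b≡c) cn bn in separates⇒separable k (inj₂ (q , p))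
    go true  true  bn cn = contradiction (trans bn (sym cn)) bn≢cn
    go false false bn cn = contradiction (trans bn (sym cn)) bn≢cn

  limit-injective : ∀ {b c} → limit b ≈ limit c → ∀ n → b n ≡ c n
  limit-injective {b} {c} eq n = byContradiction λ bn≢cn →
    separable⇒≇ (limit-separable {b} {c} λ b≗c → bn≢cn (b≗c n)) (≈⇒≅ eq)

  -- Closed under pointwise equality, and so a genuine subset of the setoid of structures.
  Limits : Pred (X L) 0ℓ
  Limits x = ∃[ b ] x ≈ limit b

  limits-models : SetOfModels T Limits
  limits-models (b , x≈) {φ} φ∈T σ =
    E.from (⊨-iso (≈⇒≅ x≈) φ (λ _ _ → refl)) (limit-models b φ∈T σ)

  limits-continuum : HasSizeContinuum (SubsetOf (X-setoid L) Limits)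
  limits-continuum = record
    { to        = λ b → limit b , b , λ _ _ → refl
    ; cong      = limit-cong
    ; bijective = limit-injective
                , λ (_ , b , x≈) → b , λ c≗b i s → trans (limit-cong c≗b i s) (sym (x≈ i s))
    }

  limits-separable : Pairwise (Separable F) Limits
  limits-separable {x} {y} (b , x≈) (c , y≈) x≉y =
    separable-resp-≅ (≈⇒≅ (λ i s → sym (x≈ i s))) (≈⇒≅ y≈) (limit-separable λ b≗c →
      x≉y λ i s → trans (x≈ i s) (trans (limit-cong b≗c i s) (sym (y≈ i s))))

corollary0p3 : ExcludedMiddle 0ℓ →
    (L : Language) → Symbol L → CountableLanguage L →
    (T : Pred (Formula L) 0ℓ) → IsFirstOrderTheory T →
    (F : Pred (Formula L) 0ℓ) → IsFragment F → CountableFormulas F →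
    (Σ[ S ∈ Pred (X L) 0ℓ ]
    SetOfModels T S
    × ¬ Countable (SubsetOf (X-setoid L) S)
    × Pairwise (Separable F) S) →
    (Σ[ S ∈ Pred (X L) 0ℓ ]
    SetOfModels T S
    × HasSizeContinuum (SubsetOf (X-setoid L) S)
    × Pairwise (Separable F) S)
    × (Σ[ S ∈ Pred (X L) 0ℓ ]
    SetOfModels T S
    × HasSizeContinuum (SubsetOf (X-setoid L) S)
    × Pairwise (λ x y → ¬ (x ≅ y)) S)
corollary0p3 em L _ _ T isTheory F isFragment F-countable (S , models , uncountable , separable) =
    (Lim , ms , size , sep)
  , (Lim , ms , size , λ x∈ y∈ x≉y → separable⇒≇ (sep x∈ y∈ x≉y))
  where
  Lim  = Limits em isTheory isFragment F-countable models uncountable separable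
  ms   : SetOfModels T Lim
  ms   = limits-models em isTheory isFragment F-countable models uncountable separable
  size : HasSizeContinuum (SubsetOf (X-setoid L) Lim)
  size = limits-continuum em isTheory isFragment F-countable models uncountable separable
  sep  : Pairwise (Separable F) Lim
  sep  = limits-separable em isTheory isFragment F-countable models uncountable separable
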